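{- In any minimal counterexample to Hadwiger's Conjecture among graphs with no stable set of size $3$, every vertex lies in some induced subgraph isomorphic to the $5$-cycle $C_5$.
   Context: All graphs are finite and simple. $h(G)$ is the largest $t$ such that $K_t$ is a minor of $G$, and $\chi(G)$ is the chromatic number. A counterexample is a graph $G$ with no stable set of size $3$ and $h(G)<\chi(G)$. A minimal counterexample is a counterexample none of whose proper induced subgraphs is a counterexample. -}

module Defs where

open import Data.Nat using (ℕ; _<_; _≤_; _%_; _+_)
open import Data.Nat.Base using (_≡ᵇ_)
open import Data.Bool using (Bool; true; false; _∨_)
open import Data.Bool.Properties using (∨-comm)
open import Data.Fin using (Fin; toℕ; zero; suc)
open import Data.Maybe using (Maybe; just)
open import Data.Product using (Σ; ∃; _×_; _,_)
open import Function.Definitions using (Injective)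
open import Function.Bundles using (_⇔_)
open import Relation.Binary.PropositionalEquality using (_≡_; _≢_)
open import Relation.Nullary using (¬_)

record Graph : Set where
  field
    n      : ℕ
    adj    : Fin n → Fin n → Bool
    sym    : ∀ u v → adj u v ≡ adj v u
    irrefl : ∀ u → adj u u ≡ false
open Graph public

V : Graph → Set
V G = Fin (n G)

E : (G : Graph) → V G → V G → Set
E G u v = adj G u v ≡ true

HasStable3 : Graph → Set
HasStable3 G = Σ (V G) λ a → Σ (V G) λ b → Σ (V G) λ c →
  (a ≢ b) × (a ≢ c) × (b ≢ c) × ¬ E G a b × ¬ E G a c × ¬ E G b c

Colourable : Graph → ℕ → Set
Colourable G k = Σ (V G → Fin k) λ col → ∀ u v → E G u v → col u ≢ col v

IsChromatic : Graph → ℕ → Set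
IsChromatic G k = Colourable G k × (∀ j → Colourable G j → k ≤ j)

data WalkIn (G : Graph) (P : V G → Set) : V G → V G → Set where
  stop : ∀ {u} → P u → WalkIn G P u u
  step : ∀ {u w v} → P u → E G u w → WalkIn G P w v → WalkIn G P u v

-- K_t minor: branch sets given by a partial map β : V G → Maybe (Fin t)
-- (branch set i = β⁻¹(just i)); automatically pairwise disjoint.
-- Each branch set is non-empty and connected, and any two distinct branch
-- sets are joined by an edge.
HasKMinor : Graph → ℕ → Set
HasKMinor G t = Σ (V G → Maybe (Fin t)) λ β →
  (∀ i → Σ (V G) λ v → β v ≡ just i) ×
  (∀ i u v → β u ≡ just i → β v ≡ just i → WalkIn G (λ w → β w ≡ just i) u v) ×
  (∀ i j → i ≢ j → Σ (V G) λ u → Σ (V G) λ v →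
      β u ≡ just i × β v ≡ just j × E G u v)

IsHadwiger : Graph → ℕ → Set
IsHadwiger G h = HasKMinor G h × (∀ t → HasKMinor G t → t ≤ h)

Counterexample : Graph → Set
Counterexample G = ¬ HasStable3 G ×
  Σ ℕ λ h → Σ ℕ λ χ → IsHadwiger G h × IsChromatic G χ × h < χ

induced : (G : Graph) (m : ℕ) (f : Fin m → V G) → Graph
induced G m f = record
  { n = m
  ; adj = λ i j → adj G (f i) (f j)
  ; sym = λ i j → sym G (f i) (f j)
  ; irrefl = λ i → irrefl G (f i) }

MinimalCounterexample : Graph → Set
MinimalCounterexample G = Counterexample G ×
  (∀ m (f : Fin m → V G) → Injective _≡_ _≡_ f → m < n G →
     ¬ Counterexample (induced G m f))

c5adj : Fin 5 → Fin 5 → Bool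
c5adj i j = (toℕ j ≡ᵇ (toℕ i + 1) % 5) ∨ (toℕ i ≡ᵇ (toℕ j + 1) % 5)

c5irr : ∀ i → c5adj i i ≡ false
c5irr zero = _≡_.refl
c5irr (suc zero) = _≡_.refl
c5irr (suc (suc zero)) = _≡_.refl
c5irr (suc (suc (suc zero))) = _≡_.refl
c5irr (suc (suc (suc (suc zero)))) = _≡_.refl

C5 : Graph
C5 = record
  { n = 5
  ; adj = c5adj
  ; sym = λ i j → ∨-comm (toℕ j ≡ᵇ (toℕ i + 1) % 5) (toℕ i ≡ᵇ (toℕ j + 1) % 5)
  ; irrefl = c5irr }

InInducedC5 : (G : Graph) → V G → Set
InInducedC5 G v = Σ (V C5 → V G) λ f →
  Injective _≡_ _≡_ f ×
  (∀ i j → E G (f i) (f j) ⇔ E C5 i j) ×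
  (Σ (V C5) λ i → f i ≡ v)

{-# OPTIONS --safe #-}
module Submission where

-- Let G be a minimal counterexample with chromatic number χ. As no three vertices are stable, colourings
-- of G correspond to matchings of its complement, and by minimality every vertex is exposed by some
-- optimal matching. Hence (Gallai) "no optimal matching exposes both x and y" is an equivalence relation ~
-- containing all nonadjacent pairs. An edge pq with p ~ q cannot dominate G: deleting p and q lowers χ by
-- at most one, and {p, q} is a further branch set for a minor of the rest.
-- Suppose v is in no induced C5, let B be its set of non-neighbours and M an optimal matching exposing v.
-- Every b in B has a mate a, a neighbour of v. If a were nonadjacent to some other neighbour w of v, the
-- absence of a C5 would make w complete to B, so that vw would dominate G although v ~ b ~ a ~ w. So a is
-- adjacent to everything outside B, a colouring of G - B extends to G by giving each b the colour of its
-- mate, and χ(G - B) ≥ χ(G) contradicts minimality. If B is empty, v itself dominates G.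

open import Defs hiding (n; sym)

open import Data.Bool using (true)
import Data.Bool.Properties as Bool
open import Data.Empty using (⊥; ⊥-elim)
open import Data.Fin as Fin using (Fin; zero; suc; _↑ˡ_; _↑ʳ_)
open import Data.Fin.Patterns using (0F; 1F; 2F; 3F; 4F)
import Data.Fin.Properties as Fin
open import Data.Fin.Permutation.Components using (transpose; transpose-inverse)
open import Data.List using (List; []; _∷_; allFin; filter; length; lookup)
open import Data.List.Membership.Propositional using (lose)
open import Data.List.Membership.Propositional.Properties using (∈-allFin; ∈-filter⁺; ∈-filter⁻; ∈-lookup)
open import Data.List.Properties using (filter-notAll; length-tabulate)
import Data.List.Relation.Unary.All as All
open import Data.List.Relation.Unary.AllPairs using (_∷_)
open import Data.List.Relation.Unary.Any using (index)
open import Data.List.Relation.Unary.Any.Properties using (lookup-index)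
open import Data.List.Relation.Unary.Unique.Propositional using (Unique)
open import Data.List.Relation.Unary.Unique.Propositional.Properties using (allFin⁺; filter⁺)
open import Data.Maybe as Maybe using (Maybe; just; nothing)
open import Data.Maybe.Properties using (just-injective)
open import Data.Nat using (ℕ; zero; suc; _+_; _≤_; _<_; _≮_; _∸_; s≤s)
import Data.Nat.Properties as ℕ
open import Data.Product using (Σ; ∃; _×_; _,_; proj₁; proj₂)
open import Data.Sum using (_⊎_; inj₁; inj₂; [_,_]′)
open import Function using (_∘_; id)
open import Function.Bundles using (mk⇔)
open import Function.Definitions using (Injective)
open import Relation.Binary.PropositionalEquality using (_≡_; _≢_; refl; sym; trans; cong; cong₂; subst; subst₂)
open import Relation.Nullary using (¬_; Dec; yes; no; contradiction)
open import Relation.Nullary.Decidable using (¬?; _×-dec_; _→-dec_; decidable-stable; from-yes)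
open import Relation.Unary using (Pred; Decidable)
open import Level using (0ℓ)

-- Counting the elements of a decidable subset

lookup-injective : ∀ {A : Set} {xs : List A} → Unique xs → ∀ i j → lookup xs i ≡ lookup xs j → i ≡ j
lookup-injective (_ ∷ _) zero zero _ = refl
lookup-injective (x∉ ∷ _) zero (suc j) eq = contradiction eq (All.lookup x∉ (∈-lookup j))
lookup-injective (x∉ ∷ _) (suc i) zero eq = contradiction (sym eq) (All.lookup x∉ (∈-lookup i))
lookup-injective (_ ∷ u) (suc i) (suc j) eq = cong suc (lookup-injective u i j eq)

length-filter-∪∩ : ∀ {A : Set} {P Q : Pred A 0ℓ} (P? : Decidable P) (Q? : Decidable Q) →
  (∀ x → P x ⊎ Q x) → (xs : List A) →
  length (filter P? xs) + length (filter Q? xs) ≡ length xs + length (filter (λ x → P? x ×-dec Q? x) xs)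
length-filter-∪∩ P? Q? total [] = refl
length-filter-∪∩ P? Q? total (x ∷ xs) with ih ← length-filter-∪∩ P? Q? total xs | P? x | Q? x
... | yes _ | yes _ = cong suc (trans (ℕ.+-suc _ _) (trans (cong suc ih) (sym (ℕ.+-suc _ _))))
... | yes _ | no _ = cong suc ih
... | no _ | yes _ = trans (ℕ.+-suc _ _) (cong suc ih)
... | no ¬p | no ¬q = ⊥-elim ([ ¬p , ¬q ]′ (total x))

private variable
  n m : ℕ
  P Q : Pred (Fin n) 0ℓ

#_ : Decidable {A = Fin n} P → ℕ
# P? = length (filter P? (allFin _))

enum : (P? : Decidable {A = Fin n} P) → Fin (# P?) → Fin n
enum P? = lookup (filter P? (allFin _))

enum-injective : (P? : Decidable {A = Fin n} P) → Injective _≡_ _≡_ (enum P?)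
enum-injective P? = lookup-injective (filter⁺ P? (allFin⁺ _)) _ _

enum-sound : (P? : Decidable {A = Fin n} P) → ∀ i → P (enum P? i)
enum-sound P? i = proj₂ (∈-filter⁻ P? {xs = allFin _} (∈-lookup i))

rank : (P? : Decidable {A = Fin n} P) → ∀ u → P u → Fin (# P?)
rank P? u pu = index (∈-filter⁺ P? (∈-allFin u) pu)

enum-rank : (P? : Decidable {A = Fin n} P) → ∀ u (pu : P u) → enum P? (rank P? u pu) ≡ u
enum-rank P? u pu = sym (lookup-index (∈-filter⁺ P? (∈-allFin u) pu))

#-injective⇒≤ : (P? : Decidable {A = Fin n} P) (φ : Fin n → Fin m) →
  (∀ u w → P u → P w → φ u ≡ φ w → u ≡ w) → # P? ≤ m
#-injective⇒≤ P? φ inj = Fin.injective⇒≤ {f = φ ∘ enum P?}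
  λ eq → enum-injective P? (inj _ _ (enum-sound P? _) (enum-sound P? _) eq)

#-mono : (P? : Decidable {A = Fin n} P) (Q? : Decidable {A = Fin n} Q) (φ : Fin n → Fin n) →
  Injective _≡_ _≡_ φ → (∀ u → P u → Q (φ u)) → # P? ≤ # Q?
#-mono P? Q? φ inj P⇒Q = Fin.injective⇒≤
  {f = λ i → rank Q? (φ (enum P? i)) (P⇒Q _ (enum-sound P? i))}
  λ eq → enum-injective P? (inj (trans (sym (enum-rank Q? _ _)) (trans (cong (enum Q?) eq) (enum-rank Q? _ _))))

#-mono-< : (P? : Decidable {A = Fin n} P) (Q? : Decidable {A = Fin n} Q) (φ : Fin n → Fin n) →
  Injective _≡_ _≡_ φ → (∀ u → P u → Q (φ u)) → ∀ w → Q w → (∀ u → P u → φ u ≢ w) → # P? < # Q?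
#-mono-< {Q = Q} P? Q? φ inj P⇒Q w qw miss = Fin.injective⇒≤ {f = ψ} ψ-injective
  where
  -- The point `w` missed by `φ` takes the extra index `zero`.
  ψ : Fin (suc (# P?)) → Fin (# Q?)
  ψ zero = rank Q? w qw
  ψ (suc i) = rank Q? (φ (enum P? i)) (P⇒Q _ (enum-sound P? i))
  ψ-value : ∀ {a b} {qa : Q a} {qb : Q b} → rank Q? a qa ≡ rank Q? b qb → a ≡ b
  ψ-value eq = trans (sym (enum-rank Q? _ _)) (trans (cong (enum Q?) eq) (enum-rank Q? _ _))
  ψ-injective : Injective _≡_ _≡_ ψ
  ψ-injective {zero} {zero} _ = refl
  ψ-injective {zero} {suc j} eq = contradiction (sym (ψ-value eq)) (miss _ (enum-sound P? j))
  ψ-injective {suc i} {zero} eq = contradiction (ψ-value eq) (miss _ (enum-sound P? i))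
  ψ-injective {suc i} {suc j} eq = cong suc (enum-injective P? (inj (ψ-value eq)))

#<n : (P? : Decidable {A = Fin n} P) → ∀ u → ¬ P u → # P? < n
#<n {n = n} P? u ¬pu = subst (# P? <_) (length-tabulate {n = n} id)
  (filter-notAll P? (allFin _) (lose (∈-allFin u) ¬pu))

-- Abstract, so that case splits on u ≟ x do not unfold it.
abstract
  swap : Fin n → Fin n → Fin n → Fin n
  swap = transpose

  swap-l : ∀ (i j : Fin n) → swap i j i ≡ j
  swap-l i j with i Fin.≟ i
  ... | yes _ = refl
  ... | no i≢i = contradiction refl i≢i

  swap-r : ∀ (i j : Fin n) → swap i j j ≡ i
  swap-r i j with j Fin.≟ i
  ... | yes j≡i = j≡i
  ... | no _ with j Fin.≟ j
  ...   | yes _ = refl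
  ...   | no j≢j = contradiction refl j≢j

  swap-other : ∀ {i j k : Fin n} → k ≢ i → k ≢ j → swap i j k ≡ k
  swap-other {i = i} {j} {k} k≢i k≢j with k Fin.≟ i
  ... | yes k≡i = contradiction k≡i k≢i
  ... | no _ with k Fin.≟ j
  ...   | yes k≡j = contradiction k≡j k≢j
  ...   | no _ = refl

  swap-comm : ∀ (i j k : Fin n) → swap i j k ≡ swap j i k
  swap-comm i j k = go (k Fin.≟ i) (k Fin.≟ j)
    where
    go : Dec (k ≡ i) → Dec (k ≡ j) → swap i j k ≡ swap j i k
    go (yes refl) _ = trans (swap-l k j) (sym (swap-r j k))
    go (no _) (yes refl) = trans (swap-r i k) (sym (swap-l k i))
    go (no k≢i) (no k≢j) = trans (swap-other k≢i k≢j) (sym (swap-other k≢j k≢i))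

  swap-involutive : ∀ (i j k : Fin n) → swap i j (swap i j k) ≡ k
  swap-involutive i j k = trans (cong (swap i j) (swap-comm i j k)) (transpose-inverse i j)

swap-injective : ∀ (i j : Fin n) → Injective _≡_ _≡_ (swap i j)
swap-injective i j {a} {b} eq =
  trans (sym (swap-involutive i j a)) (trans (cong (swap i j) eq) (swap-involutive i j b))

E? : (G : Graph) → ∀ u w → Dec (E G u w)
E? G u w = adj G u w Bool.≟ true

E-sym : (G : Graph) → ∀ {u w} → E G u w → E G w u
E-sym G {u} {w} e = trans (sym (Graph.sym G u w)) e

E⇒≢ : (G : Graph) → ∀ {u w} → E G u w → u ≢ w
E⇒≢ G {u} e refl with () ← trans (sym e) (irrefl G u)

triple : (G : Graph) → ¬ HasStable3 G → ∀ {a b c} → a ≢ b → a ≢ c → b ≢ c →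
  ¬ E G a b → ¬ E G a c → E G b c
triple G α≤2 {b = b} {c} p q r ¬ab ¬ac =
  decidable-stable (E? G b c) λ ¬bc → α≤2 (_ , _ , _ , p , q , r , ¬ab , ¬ac , ¬bc)

-- Matchings of the complement graph, with exposed vertices as fixed points

record Matching (G : Graph) : Set where
  field
    mate       : V G → V G
    involutive : ∀ u → mate (mate u) ≡ u
    nonadj     : ∀ u → ¬ E G u (mate u)

  mate-injective : Injective _≡_ _≡_ mate
  mate-injective {a} {b} eq = trans (sym (involutive a)) (trans (cong mate eq) (involutive b))

  exposed? : Decidable (λ u → mate u ≡ u)
  exposed? u = mate u Fin.≟ u

  exposed : ℕ
  exposed = # exposed?

  -- Each class of the partition into matched pairs and exposed singletons has exactly one lower and
  -- one upper vertex, so `# lower?` counts the classes. The two coincide exactly at exposed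
  -- vertices.
  lower? : Decidable (λ u → u Fin.≤ mate u)
  lower? u = u Fin.≤? mate u

  upper? : Decidable (λ u → mate u Fin.≤ u)
  upper? u = mate u Fin.≤? u

  #lower+#upper : # lower? + # upper? ≡ Graph.n G + exposed
  #lower+#upper = trans (length-filter-∪∩ lower? upper? (λ u → Fin.≤-total u (mate u)) (allFin _))
    (cong₂ _+_ (length-tabulate {n = Graph.n G} id) (ℕ.≤-antisym
      (#-mono both? exposed? id id λ u (l , r) → Fin.≤-antisym r l)
      (#-mono exposed? both? id id λ u eq →
        Fin.≤-reflexive (sym eq) , Fin.≤-reflexive eq)))
    where
    both? : Decidable (λ u → u Fin.≤ mate u × mate u Fin.≤ u)
    both? u = lower? u ×-dec upper? u

  #lower≤#upper : # lower? ≤ # upper?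
  #lower≤#upper = #-mono lower? upper? mate mate-injective
    λ u l → subst (Fin._≤ mate u) (sym (involutive u)) l

  root : ∀ u → ∃ λ r → r Fin.≤ mate r × (r ≡ u ⊎ r ≡ mate u)
  root u with Fin.≤-total u (mate u)
  ... | inj₁ u≤ = u , u≤ , inj₁ refl
  ... | inj₂ ≤u = mate u , subst (mate u Fin.≤_) (sym (involutive u)) ≤u , inj₂ refl

  colouring : Colourable G (# lower?)
  colouring = colour , proper
    where
    colour : V G → Fin (# lower?)
    colour u = let r , l , _ = root u in rank lower? r l
    proper : ∀ u w → E G u w → colour u ≢ colour w
    proper u w e eq with root u | root w
    ... | r , l , side | r′ , l′ , side′ = go side side′
      where
      r≡r′ : r ≡ r′
      r≡r′ = trans (sym (enum-rank lower? r l)) (trans (cong (enum lower?) eq) (enum-rank lower? r′ l′))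
      go : r ≡ u ⊎ r ≡ mate u → r′ ≡ w ⊎ r′ ≡ mate w → ⊥
      go (inj₁ p) (inj₁ q) = E⇒≢ G e (trans (sym p) (trans r≡r′ q))
      go (inj₂ p) (inj₂ q) = E⇒≢ G e (mate-injective (trans (sym p) (trans r≡r′ q)))
      go (inj₂ p) (inj₁ q) = nonadj u (subst (E G u) (trans (sym q) (trans (sym r≡r′) p)) e)
      go (inj₁ p) (inj₂ q) = nonadj w (subst (E G w) (trans (sym p) (trans r≡r′ q)) (E-sym G e))

  -- The classes are counted once by lower and once by upper vertices, each count being at least
  -- `χ`; doubling avoids a division by two.
  chromatic-bound : ∀ {χ} → (∀ j → Colourable G j → χ ≤ j) → χ + χ ≤ Graph.n G + exposed
  chromatic-bound {χ} least = subst (χ + χ ≤_) #lower+#upper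
    (ℕ.+-mono-≤ χ≤ (ℕ.≤-trans χ≤ #lower≤#upper))
    where
    χ≤ : χ ≤ # lower?
    χ≤ = least _ colouring

open Matching

matchColouring : (G : Graph) → ¬ HasStable3 G → ∀ {k} ((c , _) : Colourable G k) →
  Σ (Matching G) λ M → (Graph.n G + exposed M ≤ k + k) × (∀ u → c (mate M u) ≡ c u)
matchColouring G α≤2 {k} (c , proper) = M , bound , same
  where
  partner : ∀ u → Dec (∃ λ w → w ≢ u × c w ≡ c u)
  partner u = Fin.any? λ w → ¬? (w Fin.≟ u) ×-dec (c w Fin.≟ c u)
  f : V G → V G
  f u with partner u
  ... | yes (w , _) = w
  ... | no _ = u
  same : ∀ u → c (f u) ≡ c u
  same u with partner u
  ... | yes (_ , _ , eq) = eq
  ... | no _ = refl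
  unique : ∀ {u w} → w ≢ u → c w ≡ c u → f u ≡ w
  unique {u} {w} w≢u eq with partner u
  ... | no none = contradiction (w , w≢u , eq) none
  ... | yes (x , x≢u , eq′) = decidable-stable (x Fin.≟ w) λ x≢w →
    α≤2 (x , w , u , x≢w , x≢u , w≢u ,
         (λ e → proper _ _ e (trans eq′ (sym eq))) , (λ e → proper _ _ e eq′) , (λ e → proper _ _ e eq))
  invol : ∀ u → f (f u) ≡ u
  invol u with f u Fin.≟ u
  ... | yes eq = trans (cong f eq) eq
  ... | no fu≢u = unique (fu≢u ∘ sym) (sym (same u))
  M : Matching G
  M = record { mate = f ; involutive = invol ; nonadj = λ u e → proper _ _ e (sym (same u)) }
  sameOr : ∀ {u w} → c u ≡ c w → u ≡ w ⊎ (f u ≡ w × f w ≡ u)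
  sameOr {u} {w} eq with u Fin.≟ w
  ... | yes u≡w = inj₁ u≡w
  ... | no u≢w = inj₂ (unique (u≢w ∘ sym) (sym eq) , unique u≢w eq)
  bound : Graph.n G + exposed M ≤ k + k
  bound = subst (_≤ k + k) (#lower+#upper M) (ℕ.+-mono-≤
    -- Distinct vertices of one colour are mates, and they cannot both be lower, nor both upper.
    (#-injective⇒≤ (lower? M) c λ u w lu lw eq → [ id , (λ (p , q) →
      Fin.≤-antisym (subst (u Fin.≤_) p lu) (subst (w Fin.≤_) q lw)) ]′ (sameOr eq))
    (#-injective⇒≤ (upper? M) c λ u w lu lw eq → [ id , (λ (p , q) →
      Fin.≤-antisym (subst (Fin._≤ w) q lw) (subst (Fin._≤ u) p lu)) ]′ (sameOr eq)))

-- Gallai's lemma: being exposed together by an optimal matching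

module Optimal (G : Graph) (χ : ℕ) (bound : ∀ (M : Matching G) → χ + χ ≤ Graph.n G + exposed M)
  (critical : ∀ x → ¬ ¬ Σ (Matching G) λ M → (Graph.n G + exposed M ≤ χ + χ) × mate M x ≡ x) where

  -- Together with `bound` this is an equality, so no matching exposes fewer vertices than one that
  -- satisfies it.
  Opt : Matching G → Set
  Opt M = Graph.n G + exposed M ≤ χ + χ

  opt-least : ∀ M N → Opt M → exposed N ≮ exposed M
  opt-least M N opt lt = ℕ.<⇒≱ (ℕ.<-≤-trans (ℕ.+-monoʳ-< (Graph.n G) lt) opt) (bound N)

  _~_ : V G → V G → Set
  x ~ y = ∀ M → Opt M → mate M x ≡ x → mate M y ≡ y → x ≡ y

  -- If `M` exposed both, adding the pair `x`, `y` would leave fewer vertices exposed.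
  nonadjacent⇒~ : ∀ {x y} → ¬ E G x y → x ~ y
  nonadjacent⇒~ {x} {y} ¬xy M opt Mx My with x Fin.≟ y
  ... | yes x≡y = x≡y
  ... | no x≢y = ⊥-elim (opt-least M N opt
      (#-mono-< (exposed? N) (exposed? M) id id kept x Mx λ u Nu u≡x →
        x≢y (trans (sym u≡x) (trans (sym Nu) (trans (cong f u≡x) fx)))))
    where
    -- Both vertices are fixed by `mate M`, so composing with their transposition pairs them and
    -- changes no other value.
    τ = swap x y
    f : V G → V G
    f u = τ (mate M u)
    fx : f x ≡ y
    fx = trans (cong τ Mx) (swap-l x y)
    fy : f y ≡ x
    fy = trans (cong τ My) (swap-r x y)
    mate≢ : ∀ {u z} → mate M z ≡ z → u ≢ z → mate M u ≢ z
    mate≢ Mz u≢z eq = u≢z (mate-injective M (trans eq (sym Mz)))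
    fo : ∀ {u} → u ≢ x → u ≢ y → f u ≡ mate M u
    fo u≢x u≢y = swap-other (mate≢ Mx u≢x) (mate≢ My u≢y)
    invol : ∀ u → f (f u) ≡ u
    invol u with u Fin.≟ x | u Fin.≟ y
    ... | yes refl | _ = trans (cong f fx) fy
    ... | no _ | yes refl = trans (cong f fy) fx
    ... | no u≢x | no u≢y = trans (cong f (fo u≢x u≢y))
      (trans (fo (mate≢ Mx u≢x) (mate≢ My u≢y)) (involutive M u))
    nonadj′ : ∀ u → ¬ E G u (f u)
    nonadj′ u e with u Fin.≟ x | u Fin.≟ y
    ... | yes refl | _ = ¬xy (subst (E G u) fx e)
    ... | no _ | yes refl = ¬xy (E-sym G (subst (E G u) fy e))
    ... | no u≢x | no u≢y = nonadj M u (subst (E G u) (fo u≢x u≢y) e)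
    N : Matching G
    N = record { mate = f ; involutive = invol ; nonadj = nonadj′ }
    kept : ∀ u → f u ≡ u → mate M u ≡ u
    kept u fu with u Fin.≟ x | u Fin.≟ y
    ... | yes refl | _ = Mx
    ... | no _ | yes refl = My
    ... | no u≢x | no u≢y = trans (sym (fo u≢x u≢y)) fu

  differ? : ∀ (M N : Matching G) → Decidable (λ u → mate N u ≢ mate M u)
  differ? M N u = ¬? (mate N u Fin.≟ mate M u)

  -- If x is exposed by N and matched to y by M, exchanging the N-edge at y for xy keeps N optimal
  -- and brings it closer to M.
  exchange : ∀ M N {x} → Opt M → Opt N → mate M x ≢ x → mate N x ≡ x →
    Σ (Matching G) λ N′ → Opt N′ × (# differ? M N′ < # differ? M N) ×
      (∀ t → mate N t ≡ t → t ≢ x → mate N′ t ≡ t)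
  exchange M N {x} optM optN Mx≢x Nx = N′ , opt , closer , keep
    where
    y = mate M x
    z = mate N y
    My : mate M y ≡ x
    My = involutive M x
    Nz : mate N z ≡ y
    Nz = involutive N y
    x≢y : x ≢ y
    x≢y = Mx≢x ∘ sym
    -- Otherwise the optimal `N` would expose the nonadjacent vertices `x` and `y`.
    z≢y : z ≢ y
    z≢y Ny = x≢y (nonadjacent⇒~ (nonadj M x) N optN Nx Ny)
    z≢x : z ≢ x
    z≢x z≡x = x≢y (trans (sym Nx) (trans (cong (mate N) (sym z≡x)) Nz))
    -- Conjugating by this transposition exchanges the roles of `x` and `z`: now `y` is paired with
    -- `x`, and `z` is exposed.
    τ = swap x z
    f : V G → V G
    f u = τ (mate N (τ u))
    fx : f x ≡ y
    fx = trans (cong (τ ∘ mate N) (swap-l x z)) (trans (cong τ Nz) (swap-other (x≢y ∘ sym) (z≢y ∘ sym)))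
    fy : f y ≡ x
    fy = trans (cong (τ ∘ mate N) (swap-other (x≢y ∘ sym) (z≢y ∘ sym))) (swap-r x z)
    fz : f z ≡ z
    fz = trans (cong (τ ∘ mate N) (swap-r x z)) (trans (cong τ Nx) (swap-l x z))
    fo : ∀ {u} → u ≢ x → u ≢ y → u ≢ z → f u ≡ mate N u
    fo u≢x u≢y u≢z = trans (cong (τ ∘ mate N) (swap-other u≢x u≢z)) (swap-other
      (λ eq → u≢x (mate-injective N (trans eq (sym Nx)))) (λ eq → u≢y (mate-injective N eq)))
    nonadj′ : ∀ u → ¬ E G u (f u)
    nonadj′ u e with u Fin.≟ x | u Fin.≟ y | u Fin.≟ z
    ... | yes refl | _ | _ = nonadj M x (subst (E G x) fx e)
    ... | no _ | yes refl | _ = nonadj M y (subst (E G y) (trans fy (sym My)) e)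
    ... | no _ | no _ | yes refl = E⇒≢ G e (sym fz)
    ... | no p | no q | no r = nonadj N u (subst (E G u) (fo p q r) e)
    N′ : Matching G
    N′ = record
      { mate = f
      ; involutive = λ u → trans (cong (τ ∘ mate N) (swap-involutive x z _))
          (trans (cong τ (involutive N _)) (swap-involutive x z u))
      ; nonadj = nonadj′ }
    opt : Opt N′
    opt = ℕ.≤-trans (ℕ.+-monoʳ-≤ (Graph.n G)
      (#-mono (exposed? N′) (exposed? N) τ (swap-injective x z)
        λ u fu → trans (sym (swap-involutive x z _)) (cong τ fu))) optN
    -- At `x` the new matching agrees with `M` and the old one did not. No agreement is lost at `z`,
    -- because `M` pairs `y` with `x` and not with `z`.
    closer : # differ? M N′ < # differ? M N
    closer = #-mono-< (differ? M N′) (differ? M N) id id differ x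
      (λ eq → x≢y (trans (sym Nx) eq)) (λ u d u≡x → d (trans (cong f u≡x) (trans fx (cong (mate M) (sym u≡x)))))
      where
      differ : ∀ u → f u ≢ mate M u → mate N u ≢ mate M u
      differ u d eq with u Fin.≟ x | u Fin.≟ y | u Fin.≟ z
      ... | yes refl | _ | _ = d fx
      ... | no _ | yes refl | _ = d (trans fy (sym My))
      ... | no _ | no _ | yes refl =
        z≢x (mate-injective M (trans (sym eq) Nz))
      ... | no p | no q | no r = d (trans (fo p q r) eq)
    keep : ∀ t → mate N t ≡ t → t ≢ x → f t ≡ t
    keep t Nt t≢x with t Fin.≟ z
    ... | yes refl = fz
    ... | no t≢z = trans (fo t≢x (λ { refl → t≢z (sym Nt) }) t≢z) Nt

  -- Suppose an optimal `M` exposes distinct `x` and `y`; then it covers `t`, and an optimal `N`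
  -- exposing `t` covers `x` and `y`. Exchanges bring `N` towards `M` until `M` exposes all vertices
  -- exposed by `N` except `t`. Then `N` exposes fewer vertices than `M`: `x` makes up for `t`, and
  -- `y` is left over.
  ~-trans : ∀ {x t y} → x ~ t → t ~ y → x ~ y
  ~-trans {x} {t} {y} x~t t~y M optM Mx My with x Fin.≟ y
  ... | yes x≡y = x≡y
  ... | no x≢y = ⊥-elim (critical t λ (N , optN , Nt) → approach _ N (ℕ.≤-refl) optN Nt)
    where
    Mt≢t : mate M t ≢ t
    Mt≢t Mt = x≢y (trans (x~t M optM Mx Mt) (t~y M optM Mt My))
    -- The recursion is on a bound `k` for the number of disagreements, which every exchange lowers.
    approach : ∀ k N → # differ? M N ≤ k → Opt N → mate N t ≡ t → ⊥
    approach k N le optN Nt with Fin.any? (λ w → ¬? (w Fin.≟ t) ×-dec (mate N w Fin.≟ w) ×-dec ¬? (mate M w Fin.≟ w))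
    ... | yes (w , w≢t , Nw , Mw) with exchange M N optM optN Mw Nw
    ...   | N′ , optN′ , closer , keep with k
    ...     | zero = ℕ.n≮0 (ℕ.<-≤-trans closer le)
    ...     | suc k = approach k N′ (ℕ.≤-pred (ℕ.<-≤-trans closer le)) optN′ (keep t Nt (w≢t ∘ sym))
    approach k N le optN Nt | no none = opt-least M N optM
      (#-mono-< (exposed? N) (exposed? M) τ (swap-injective t x) into y My miss)
      where
      τ = swap t x
      Nx≢x : mate N x ≢ x
      Nx≢x Nx = Mt≢t (subst (λ u → mate M u ≡ u) (x~t N optN Nx Nt) Mx)
      Ny≢y : mate N y ≢ y
      Ny≢y Ny = Mt≢t (subst (λ u → mate M u ≡ u) (sym (t~y N optN Nt Ny)) My)
      into : ∀ u → mate N u ≡ u → mate M (τ u) ≡ τ u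
      into u Nu with u Fin.≟ t
      ... | yes refl = trans (cong (mate M) (swap-l u x)) (trans Mx (sym (swap-l u x)))
      ... | no u≢t = trans (cong (mate M) τu) (trans Mu (sym τu))
        where
        τu : τ u ≡ u
        τu = swap-other u≢t (λ { refl → Nx≢x Nu })
        Mu : mate M u ≡ u
        Mu = decidable-stable (mate M u Fin.≟ u) λ Mu≢u → none (u , u≢t , Nu , Mu≢u)
      miss : ∀ u → mate N u ≡ u → τ u ≢ y
      miss u Nu τu≡y = Ny≢y (subst (λ w → mate N w ≡ w) u≡y Nu)
        where
        u≡y : u ≡ y
        u≡y = trans (sym (swap-involutive t x u)) (trans (cong τ τu≡y)
          (swap-other (λ { refl → Mt≢t My }) (x≢y ∘ sym)))

-- Induced subgraphs: colourings and minors

HasKMinor⇒≤n : (G : Graph) → ∀ {t} → HasKMinor G t → t ≤ Graph.n G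
HasKMinor⇒≤n G (β , nonempty , _) = Fin.injective⇒≤ {f = proj₁ ∘ nonempty} λ {i} {j} eq →
  just-injective (trans (sym (proj₂ (nonempty i))) (trans (cong β eq) (proj₂ (nonempty j))))

-- `Counterexample` demands exact values of both invariants of a subgraph. For an undecided `A` the
-- extremum is obtained only up to double negation, which suffices for a refutation.
¬¬-least : (A : ℕ → Set) → ∀ k → A k → ¬ ¬ ∃ λ j → A j × (∀ i → A i → j ≤ i)
¬¬-least A k ak none = go k k ℕ.≤-refl ak
  where
  go : ∀ b k → k ≤ b → A k → ⊥
  go b k k≤b ak = none (k , ak , λ i ai → ℕ.≮⇒≥ λ i<k → below b k≤b i ai i<k)
    where
    below : ∀ b → k ≤ b → ∀ i → A i → i < k → ⊥
    below zero k≤b i ai i<k = ℕ.n≮0 (ℕ.<-≤-trans i<k k≤b)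
    below (suc b) k≤b i ai i<k = go b i (ℕ.≤-pred (ℕ.<-≤-trans i<k k≤b)) ai

¬¬-greatest : (A : ℕ → Set) → ∀ b → (∀ t → A t → t ≤ b) → ∀ k → A k →
  ¬ ¬ ∃ λ j → A j × (∀ t → A t → t ≤ j)
¬¬-greatest A b bounded k ak none = go b k (ℕ.m≤n+m b k) ak
  where
  go : ∀ d k → b ≤ k + d → A k → ⊥
  go d k le ak = none (k , ak , λ t at → ℕ.≮⇒≥ λ k<t → above d le t at k<t)
    where
    above : ∀ d → b ≤ k + d → ∀ t → A t → k < t → ⊥
    above zero le t at k<t =
      ℕ.<⇒≱ k<t (ℕ.≤-trans (bounded t at) (subst (b ≤_) (ℕ.+-identityʳ k) le))
    above (suc d) le t at k<t = go d t
      (ℕ.≤-trans (subst (b ≤_) (ℕ.+-suc k d) le) (ℕ.+-monoˡ-≤ d k<t)) at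

mapWalk : (G H : Graph) {A : V G → Set} {B : V H → Set} (f : V G → V H) →
  (∀ {u w} → E G u w → E H (f u) (f w)) → (∀ {u} → A u → B (f u)) →
  ∀ {u w} → WalkIn G A u w → WalkIn H B (f u) (f w)
mapWalk G H f edge A⇒B (stop a) = stop (A⇒B a)
mapWalk G H f edge A⇒B (step a e walk) = step (A⇒B a) (edge e) (mapWalk G H f edge A⇒B walk)

-- Vertices outside the image of `f` lie in no branch set; the second component records this,
-- leaving room there for a further branch set.
liftMinor : (G : Graph) {m : ℕ} (f : Fin m → V G) → Injective _≡_ _≡_ f → ∀ {t} →
  HasKMinor (induced G m f) t →
  Σ (HasKMinor G t) λ (β , _) → ∀ u i → β u ≡ just i → ∃ λ x → f x ≡ u
liftMinor G {m} f inj {t} (β , nonempty , connected , adjacent) =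
  (γ ,
   (λ i → let x , eq = nonempty i in f x , trans (γ-f x) eq) ,
   connected′ ,
   (λ i j i≢j → let x , y , p , q , e = adjacent i j i≢j in
     f x , f y , trans (γ-f x) p , trans (γ-f y) q , e)) ,
  λ u i eq → let x , fx , _ = γ-inv u i eq in x , fx
  where
  γ : V G → Maybe (Fin t)
  γ u with Fin.any? (λ x → f x Fin.≟ u)
  ... | yes (x , _) = β x
  ... | no _ = nothing
  γ-f : ∀ x → γ (f x) ≡ β x
  γ-f x with Fin.any? (λ y → f y Fin.≟ f x)
  ... | yes (y , eq) = cong β (inj eq)
  ... | no none = contradiction (x , refl) none
  γ-inv : ∀ u i → γ u ≡ just i → ∃ λ x → f x ≡ u × β x ≡ just i
  γ-inv u i eq with Fin.any? (λ x → f x Fin.≟ u)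
  ... | yes (x , fx) = x , fx , eq
  ... | no _ with () ← eq
  connected′ : ∀ i u w → γ u ≡ just i → γ w ≡ just i → WalkIn G (λ x → γ x ≡ just i) u w
  connected′ i u w p q with γ-inv u i p | γ-inv w i q
  ... | x , refl , βx | y , refl , βy =
    mapWalk (induced G m f) G f id (λ {z} eq → trans (γ-f z) eq) (connected i x y βx βy)

-- The new branch set consists of `p` and `q` and has label `zero`; the case `p ≡ q` serves a single
-- dominating vertex. Any vertex of an old branch set supplies the edge to the new one.
addBranchSet : (G : Graph) → ∀ {t} ((β , _) : HasKMinor G t) {p q} →
  p ≡ q ⊎ E G p q → (∀ u i → β u ≡ just i → u ≢ p × u ≢ q × (E G p u ⊎ E G q u)) →
  HasKMinor G (suc t)
addBranchSet G {t} (β , nonempty , connected , adjacent) {p} {q} pq old =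
  γ , nonempty′ , connected′ , adjacent′
  where
  γ : V G → Maybe (Fin (suc t))
  γ u with u Fin.≟ p | u Fin.≟ q
  ... | yes _ | _ = just zero
  ... | no _ | yes _ = just zero
  ... | no _ | no _ = Maybe.map suc (β u)
  γp : γ p ≡ just zero
  γp with p Fin.≟ p
  ... | yes _ = refl
  ... | no p≢p = contradiction refl p≢p
  γq : γ q ≡ just zero
  γq with q Fin.≟ p | q Fin.≟ q
  ... | yes _ | _ = refl
  ... | no _ | yes _ = refl
  ... | no _ | no q≢q = contradiction refl q≢q
  γ-suc : ∀ {u i} → β u ≡ just i → γ u ≡ just (suc i)
  γ-suc {u} {i} eq with u Fin.≟ p | u Fin.≟ q | old u i eq
  ... | yes u≡p | _ | u≢p , _ = contradiction u≡p u≢p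
  ... | no _ | yes u≡q | _ , u≢q , _ = contradiction u≡q u≢q
  ... | no _ | no _ | _ = cong (Maybe.map suc) eq
  γ-suc⁻¹ : ∀ u {i} → γ u ≡ just (suc i) → β u ≡ just i
  γ-suc⁻¹ u eq with u Fin.≟ p | u Fin.≟ q
  γ-suc⁻¹ u () | yes _ | _
  γ-suc⁻¹ u () | no _ | yes _
  γ-suc⁻¹ u eq | no _ | no _ with β u
  γ-suc⁻¹ u refl | no _ | no _ | just i = refl
  γ-zero⁻¹ : ∀ u → γ u ≡ just zero → u ≡ p ⊎ u ≡ q
  γ-zero⁻¹ u eq with u Fin.≟ p | u Fin.≟ q
  ... | yes u≡p | _ = inj₁ u≡p
  ... | no _ | yes u≡q = inj₂ u≡q
  ... | no _ | no _ with β u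
  ...   | just _ with () ← eq
  ...   | nothing with () ← eq
  nonempty′ : ∀ i → ∃ λ u → γ u ≡ just i
  nonempty′ zero = p , γp
  nonempty′ (suc i) = let u , eq = nonempty i in u , γ-suc eq
  pq-walk : p ≡ q ⊎ E G p q → WalkIn G (λ x → γ x ≡ just zero) p q
  pq-walk (inj₁ refl) = stop γp
  pq-walk (inj₂ e) = step γp e (stop γq)
  qp-walk : p ≡ q ⊎ E G p q → WalkIn G (λ x → γ x ≡ just zero) q p
  qp-walk (inj₁ refl) = stop γp
  qp-walk (inj₂ e) = step γq (E-sym G e) (stop γp)
  connected′ : ∀ i u w → γ u ≡ just i → γ w ≡ just i → WalkIn G (λ x → γ x ≡ just i) u w
  connected′ zero u w a b with γ-zero⁻¹ u a | γ-zero⁻¹ w b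
  ... | inj₁ refl | inj₁ refl = stop γp
  ... | inj₁ refl | inj₂ refl = pq-walk pq
  ... | inj₂ refl | inj₁ refl = qp-walk pq
  ... | inj₂ refl | inj₂ refl = stop γq
  connected′ (suc i) u w a b =
    mapWalk G G id id γ-suc (connected i u w (γ-suc⁻¹ u a) (γ-suc⁻¹ w b))
  touch : ∀ j → ∃ λ u → ∃ λ w → γ u ≡ just zero × γ w ≡ just (suc j) × E G u w
  touch j with nonempty j
  ... | w , eq with old w j eq
  ...   | _ , _ , inj₁ e = p , w , γp , γ-suc eq , e
  ...   | _ , _ , inj₂ e = q , w , γq , γ-suc eq , e
  adjacent′ : ∀ i j → i ≢ j → ∃ λ u → ∃ λ w → γ u ≡ just i × γ w ≡ just j × E G u w
  adjacent′ zero zero i≢j = contradiction refl i≢j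
  adjacent′ zero (suc j) _ = touch j
  adjacent′ (suc i) zero _ = let w , u , a , b , e = touch i in u , w , b , a , E-sym G e
  adjacent′ (suc i) (suc j) i≢j =
    let u , w , a , b , e = adjacent i j (i≢j ∘ cong suc) in u , w , γ-suc a , γ-suc b , e

_↾_ : (G : Graph) {A : Pred (V G) 0ℓ} → Decidable A → Graph
G ↾ A? = induced G (# A?) (enum A?)

↑ˡ≢↑ʳ : ∀ {s j} (a : Fin s) (b : Fin j) → a ↑ˡ j ≢ s ↑ʳ b
↑ˡ≢↑ʳ {s} {j} a b eq with () ←
  trans (sym (Fin.splitAt-↑ˡ s a j)) (trans (cong (Fin.splitAt s) eq) (Fin.splitAt-↑ʳ s j b))

-- Vertices outside `A` get distinct fresh colours. Each is then alone in its class, so the matching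
-- of the colouring exposes it.
extendColouring : (G : Graph) {A : Pred (V G) 0ℓ} (A? : Decidable A) → ∀ {j s} → Colourable (G ↾ A?) j →
  (g : V G → Fin s) → (∀ u w → ¬ A u → ¬ A w → g u ≡ g w → u ≡ w) →
  Σ (Colourable G (s + j)) λ (c , _) → ∀ u w → ¬ A u → c w ≡ c u → w ≡ u
extendColouring G {A} A? {j} {s} (c , proper) g g-inj = (d , d-proper) , alone
  where
  d : V G → Fin (s + j)
  d u with A? u
  ... | yes a = s ↑ʳ c (rank A? u a)
  ... | no _ = g u ↑ˡ j
  alone : ∀ u w → ¬ A u → d w ≡ d u → w ≡ u
  alone u w ¬a eq with A? u | A? w
  ... | yes a | _ = contradiction a ¬a
  ... | no _ | yes b = contradiction (sym eq) (↑ˡ≢↑ʳ _ _)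
  ... | no _ | no ¬b = g-inj w u ¬b ¬a (Fin.↑ˡ-injective j _ _ eq)
  d-proper : ∀ u w → E G u w → d u ≢ d w
  d-proper u w e eq with A? u | A? w
  ... | yes a | yes b = proper _ _
        (subst₂ (E G) (sym (enum-rank A? u a)) (sym (enum-rank A? w b)) e) (Fin.↑ʳ-injective s _ _ eq)
  ... | yes _ | no _ = ↑ˡ≢↑ʳ _ _ (sym eq)
  ... | no _ | yes _ = ↑ˡ≢↑ʳ _ _ eq
  ... | no ¬a | no ¬b = E⇒≢ G e (g-inj u w ¬a ¬b (Fin.↑ˡ-injective j _ _ eq))

-- The pentagon

-- Boolean equations make the existence of a pattern decidable. Injectivity is recovered later, as
-- no two vertices of the pentagon have the same neighbours.
C5Pattern : (G : Graph) → (v a c d b : V G) → Set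
C5Pattern G v a c d b = ∀ i j → adj G (f i) (f j) ≡ c5adj i j
  where f = lookup (v ∷ a ∷ c ∷ d ∷ b ∷ [])

c5Pattern : (G : Graph) → ∀ {v a c d b} → E G v a → E G a c → E G c d → E G d b → E G b v →
  ¬ E G v c → ¬ E G v d → ¬ E G a d → ¬ E G a b → ¬ E G c b → C5Pattern G v a c d b
c5Pattern G va ac cd db bv ¬vc ¬vd ¬ad ¬ab ¬cb = λ where
  0F 0F → irrefl G _
  1F 1F → irrefl G _
  2F 2F → irrefl G _
  3F 3F → irrefl G _
  4F 4F → irrefl G _
  0F 1F → va
  1F 0F → E-sym G va
  1F 2F → ac
  2F 1F → E-sym G ac
  2F 3F → cd
  3F 2F → E-sym G cd
  3F 4F → db
  4F 3F → E-sym G db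
  4F 0F → bv
  0F 4F → E-sym G bv
  0F 2F → Bool.¬-not ¬vc
  2F 0F → Bool.¬-not (¬vc ∘ E-sym G)
  0F 3F → Bool.¬-not ¬vd
  3F 0F → Bool.¬-not (¬vd ∘ E-sym G)
  1F 3F → Bool.¬-not ¬ad
  3F 1F → Bool.¬-not (¬ad ∘ E-sym G)
  1F 4F → Bool.¬-not ¬ab
  4F 1F → Bool.¬-not (¬ab ∘ E-sym G)
  2F 4F → Bool.¬-not ¬cb
  4F 2F → Bool.¬-not (¬cb ∘ E-sym G)

HasC5Pattern : (G : Graph) → V G → Set
HasC5Pattern G v = ∃ λ a → ∃ λ c → ∃ λ d → ∃ λ b → C5Pattern G v a c d b

hasC5Pattern? : (G : Graph) → Decidable (HasC5Pattern G)
hasC5Pattern? G v = Fin.any? λ a → Fin.any? λ c → Fin.any? λ d → Fin.any? λ b →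
  Fin.all? λ i → Fin.all? λ j → _ Bool.≟ _

HasC5Pattern⇒InInducedC5 : (G : Graph) → ∀ {v} → HasC5Pattern G v → InInducedC5 G v
HasC5Pattern⇒InInducedC5 G {v} (a , c , d , b , same) =
  f ,
  (λ {i} {j} eq → twin-free i j λ k →
    trans (sym (same i k)) (trans (cong (λ x → adj G x (f k)) eq) (same j k))) ,
  (λ i j → mk⇔ (trans (sym (same i j))) (trans (same i j))) ,
  zero , refl
  where
  f = lookup (v ∷ a ∷ c ∷ d ∷ b ∷ [])
  twin-free : ∀ i j → (∀ k → c5adj i k ≡ c5adj j k) → i ≡ j
  twin-free = from-yes (Fin.all? λ i → Fin.all? λ j →
    Fin.all? (λ k → c5adj i k Bool.≟ c5adj j k) →-dec (i Fin.≟ j))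

-- Consequences of minimality

module Minimal (G : Graph) (α≤2 : ¬ HasStable3 G) (h χ : ℕ)
  (hadwiger : ∀ t → HasKMinor G t → t ≤ h) (chromatic : ∀ j → Colourable G j → χ ≤ j) (h<χ : h < χ)
  (minimal : ∀ m (f : Fin m → V G) → Injective _≡_ _≡_ f → m < Graph.n G → ¬ Counterexample (induced G m f))
  where

  -- A proper induced subgraph also has no stable triple, so by minimality its Hadwiger number is at
  -- least its chromatic number, hence at least `k`.
  minorInduced : ∀ m (f : Fin m → V G) → Injective _≡_ _≡_ f → m < Graph.n G →
    ∀ k → (∀ j → Colourable (induced G m f) j → k ≤ j) →
    ¬ ¬ ∃ λ t → k ≤ t × HasKMinor (induced G m f) t
  minorInduced m f inj m<n k k-least none =
    ¬¬-least (Colourable H) m (id , λ u w → E⇒≢ H) λ (χ′ , col , least) →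
    ¬¬-greatest (HasKMinor H) m (λ _ → HasKMinor⇒≤n H) 0 empty λ (h′ , minor , greatest) →
    minimal m f inj m<n (α′ , h′ , χ′ , (minor , greatest) , (col , least) ,
      ℕ.≰⇒> λ χ′≤h′ → none (h′ , ℕ.≤-trans (k-least _ col) χ′≤h′ , minor))
    where
    H = induced G m f
    empty : HasKMinor H 0
    empty = (λ _ → nothing) , (λ ()) , (λ ()) , λ ()
    α′ : ¬ HasStable3 H
    α′ (a , b , c , p , q , r , rest) = α≤2 (f a , f b , f c , p ∘ inj , q ∘ inj , r ∘ inj , rest)

  -- Otherwise the subgraph would have a complete minor with at least `χ` branch sets, which lifts
  -- to `G` against `h < χ`.
  colourInduced : {A : Pred (V G) 0ℓ} (A? : Decidable A) → ∀ u → ¬ A u →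
    ¬ ¬ ∃ λ j → j < χ × Colourable (G ↾ A?) j
  colourInduced A? u ¬a none =
    minorInduced _ (enum A?) (enum-injective A?) (#<n A? u ¬a) χ
      (λ j col → ℕ.≮⇒≥ λ j<χ → none (j , j<χ , col)) λ (t , χ≤t , minor) →
    ℕ.<⇒≱ h<χ (ℕ.≤-trans χ≤t (hadwiger t (proj₁ (liftMinor G (enum A?) (enum-injective A?) minor))))

  avoid? : ∀ (p q : V G) → Decidable (λ u → u ≢ p × u ≢ q)
  avoid? p q u = ¬? (u Fin.≟ p) ×-dec ¬? (u Fin.≟ q)

  ¬avoid : ∀ {p q : V G} u → ¬ (u ≢ p × u ≢ q) → u ≡ p ⊎ u ≡ q
  ¬avoid {p} {q} u ¬a with u Fin.≟ p | u Fin.≟ q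
  ... | yes u≡p | _ = inj₁ u≡p
  ... | no _ | yes u≡q = inj₂ u≡q
  ... | no u≢p | no u≢q = contradiction (u≢p , u≢q) ¬a

  extendByVertex : ∀ x {j} → Colourable (G ↾ avoid? x x) j →
    Σ (Colourable G (suc j)) λ (c , _) → ∀ w → c w ≡ c x → w ≡ x
  extendByVertex x col =
    let col′ , alone = extendColouring G (avoid? x x) col (λ _ → zero)
          λ u w ¬u ¬w _ → trans ([ id , id ]′ (¬avoid u ¬u)) (sym ([ id , id ]′ (¬avoid w ¬w)))
    in col′ , λ w → alone x w λ (x≢x , _) → x≢x refl

  -- Colour `G` minus `x` with fewer than `χ` colours and add `x` as a class of its own: at most `χ`
  -- colours are used, and the matching exposes `x`.
  critical : ∀ x → ¬ ¬ Σ (Matching G) λ M → (Graph.n G + exposed M ≤ χ + χ) × mate M x ≡ x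
  critical x none = colourInduced (avoid? x x) x (λ (x≢x , _) → x≢x refl) λ (j , j<χ , col) →
    let col′ , alone = extendByVertex x col
        M , size , same = matchColouring G α≤2 col′
    in none (M , ℕ.≤-trans size (ℕ.+-mono-≤ j<χ j<χ) , alone _ (same x))

  open Optimal G χ (λ M → chromatic-bound M chromatic) critical public

  -- The rest has a complete minor with at least `χ ∸ 1` branch sets, and `p`, `q` form one more:
  -- too many for `h < χ`.
  noDominating : ∀ p q → p ≡ q ⊎ E G p q → (∀ u → u ≢ p → u ≢ q → E G p u ⊎ E G q u) →
    (∀ j → Colourable (G ↾ avoid? p q) j → χ ≤ suc j) → ⊥
  noDominating p q pq dominating χ≤1+ =
    minorInduced _ f (enum-injective A?) (#<n A? p λ (p≢p , _) → p≢p refl) (χ ∸ 1)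
      (λ j col → ℕ.m≤n+o⇒m∸n≤o χ 1 (χ≤1+ j col)) λ (t , k≤t , minor) →
    let minor′ , support = liftMinor G f (enum-injective A?) minor
        minor⁺ = addBranchSet G minor′ pq λ u i eq →
          let x , fx = support u i eq
              u≢p , u≢q = subst (λ w → w ≢ p × w ≢ q) fx (enum-sound A? x)
          in u≢p , u≢q , dominating u u≢p u≢q
    -- Truncation is harmless: `χ ≤ 1 + (χ ∸ 1)` holds even for `χ` zero.
    in ℕ.<⇒≱ h<χ (ℕ.≤-trans (ℕ.≤-trans (ℕ.m≤n+m∸n χ 1) (s≤s k≤t)) (hadwiger (suc t) minor⁺))
    where
    A? = avoid? p q
    f = enum A?

  noDominatingVertex : ∀ p → ¬ (∀ u → u ≢ p → E G p u)
  noDominatingVertex p dominating = noDominating p p (inj₁ refl) (λ u u≢p _ → inj₁ (dominating u u≢p))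
    λ j col → chromatic _ (proj₁ (extendByVertex p col))

  -- If two colours fewer than `χ` sufficed for the rest, separate new colours for `p` and `q` would
  -- yield an optimal matching exposing both, against `p ~ q`.
  noDominatingEdge : ∀ {p q} → E G p q → p ~ q → ¬ (∀ u → u ≢ p → u ≢ q → E G p u ⊎ E G q u)
  noDominatingEdge {p} {q} e p~q dominating = noDominating p q (inj₂ e) dominating λ j col →
    ℕ.≮⇒≥ λ 1+j<χ →
      let col′ , alone = extendColouring G (avoid? p q) col g g-injective
          M , size , same = matchColouring G α≤2 col′
      in E⇒≢ G e (p~q M (ℕ.≤-trans size (ℕ.+-mono-≤ 1+j<χ 1+j<χ))
           (alone p _ (λ (p≢p , _) → p≢p refl) (same p)) (alone q _ (λ (_ , q≢q) → q≢q refl) (same q)))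
    where
    g : V G → Fin 2
    g u with u Fin.≟ p
    ... | yes _ = zero
    ... | no _ = suc zero
    g-injective : ∀ u w → ¬ (u ≢ p × u ≢ q) → ¬ (w ≢ p × w ≢ q) → g u ≡ g w → u ≡ w
    g-injective u w ¬u ¬w eq with u Fin.≟ p | w Fin.≟ p | ¬avoid u ¬u | ¬avoid w ¬w
    ... | yes u≡p | yes w≡p | _ | _ = trans u≡p (sym w≡p)
    ... | no u≢p | _ | inj₁ u≡p | _ = contradiction u≡p u≢p
    ... | _ | no w≢p | _ | inj₁ w≡p = contradiction w≡p w≢p
    ... | no _ | no _ | inj₂ u≡q | inj₂ w≡q = trans u≡q (sym w≡q)
    ... | yes _ | no _ | _ | inj₂ _ with () ← eq
    ... | no _ | yes _ | inj₂ _ | _ with () ← eq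

  distinct : ∀ {x y z} → E G x y → ¬ E G x z → y ≢ z
  distinct xy ¬xz refl = ¬xz xy

  -- Vertices in no induced pentagon

  module _ (v : V G) where

    Far : V G → Set
    Far u = u ≢ v × ¬ E G v u

    far? : Decidable Far
    far? u = ¬? (u Fin.≟ v) ×-dec ¬? (E? G v u)

    near : ∀ {u} → u ≢ v → ¬ Far u → E G v u
    near {u} u≢v ¬far = decidable-stable (E? G v u) λ ¬vu → ¬far (u≢v , ¬vu)

    -- A far `c` nonadjacent to `w` would close an induced pentagon `v`, `a`, `c`, `d`, `w`, whose
    -- edges `ac`, `cd` and `wd` are forced by the absence of stable triples.
    completeToFar : ¬ HasC5Pattern G v → ∀ {a w d} → E G v a → E G v w → a ≢ w → ¬ E G a w →
      Far d → ¬ E G a d → ∀ c → Far c → E G w c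
    completeToFar none {a} {w} {d} va vw a≢w ¬aw (d≢v , ¬vd) ¬ad c (c≢v , ¬vc) =
      decidable-stable (E? G w c) λ ¬wc →
        let ac = triple G α≤2 (a≢w ∘ sym) (distinct vw ¬vc) (distinct va ¬vc) (¬aw ∘ E-sym G) ¬wc
            wd = triple G α≤2 a≢w (distinct va ¬vd) (distinct vw ¬vd) ¬aw ¬ad
            cd = triple G α≤2 (c≢v ∘ sym) (d≢v ∘ sym) (distinct wd ¬wc ∘ sym) ¬vc ¬vd
        in none (a , c , d , w , c5Pattern G va ac cd (E-sym G wd) (E-sym G vw)
             ¬vc ¬vd ¬ad ¬aw (¬wc ∘ E-sym G))

    module _ (none : ¬ HasC5Pattern G v) (M : Matching G) (opt : Opt M) (Mv : mate M v ≡ v) where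

      -- Since `M` exposes `v`, it covers the nonadjacent `d`; a mate nonadjacent to `v` would
      -- complete a stable triple with `v` and `d`.
      mate-near : ∀ {d} → Far d → E G v (mate M d)
      mate-near {d} (d≢v , ¬vd) = decidable-stable (E? G v (mate M d)) λ ¬va →
        nonadj M d (triple G α≤2 (d≢v ∘ sym)
          (λ v≡a → d≢v (mate-injective M (trans (sym v≡a) (sym Mv))))
          (λ d≡a → d≢v (sym (nonadjacent⇒~ ¬vd M opt Mv (sym d≡a)))) ¬vd ¬va)

      mate-complete : ∀ {d} → Far d → ∀ {w} → ¬ Far w → w ≢ mate M d → E G (mate M d) w
      mate-complete {d} far-d@(_ , ¬vd) {w} near-w w≢a with w Fin.≟ v
      ... | yes refl = E-sym G (mate-near far-d)
      ... | no w≢v = decidable-stable (E? G a w) λ ¬aw →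
        noDominatingEdge vw (~-trans (nonadjacent⇒~ ¬vd) (~-trans (nonadjacent⇒~ (nonadj M d)) (nonadjacent⇒~ ¬aw)))
          λ u u≢v _ → dominated ¬aw u u≢v
        where
        a = mate M d
        vw = near w≢v near-w
        dominated : ¬ E G a w → ∀ u → u ≢ v → E G v u ⊎ E G w u
        dominated ¬aw u u≢v with E? G v u
        ... | yes vu = inj₁ vu
        ... | no ¬vu = inj₂ (completeToFar none (mate-near far-d) vw (w≢a ∘ sym) ¬aw far-d
                (nonadj M d ∘ E-sym G) u (u≢v , ¬vu))

      -- Each far vertex may reuse the colour of its mate, which is universal among the near vertices.
      recolour : ∀ {j} → Colourable (G ↾ (λ u → ¬? (far? u))) j → Colourable G j
      recolour {j} (c , proper) = colour , colour-proper
        where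
        near? = λ u → ¬? (far? u)
        mate-¬far : ∀ {d} → Far d → ¬ Far (mate M d)
        mate-¬far far-d (_ , ¬va) = ¬va (mate-near far-d)
        colour : V G → Fin j
        colour u with far? u
        ... | yes far-u = c (rank near? (mate M u) (mate-¬far far-u))
        ... | no near-u = c (rank near? u near-u)
        proper′ : ∀ {u w} {p : ¬ Far u} {q : ¬ Far w} → E G u w → c (rank near? u p) ≢ c (rank near? w q)
        proper′ e = proper _ _ (subst₂ (E G) (sym (enum-rank near? _ _)) (sym (enum-rank near? _ _)) e)
        colour-proper : ∀ u w → E G u w → colour u ≢ colour w
        colour-proper u w e with far? u | far? w
        ... | yes far-u | yes far-w = proper′ (mate-complete far-u (mate-¬far far-w)
          λ eq → E⇒≢ G e (sym (mate-injective M eq)))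
        -- Being adjacent to `u`, the vertex `w` is not its mate.
        ... | yes far-u | no near-w = proper′ (mate-complete far-u near-w (distinct e (nonadj M u)))
        ... | no near-u | yes far-w = proper′ (E-sym G
          (mate-complete far-w near-u (distinct (E-sym G e) (nonadj M w))))
        ... | no _ | no _ = proper′ e

    -- Decidability of the pattern permits arguing by contradiction, where the double negations are
    -- discharged. A far vertex `d` makes the subgraph of the other vertices proper.
    hasC5Pattern : HasC5Pattern G v
    hasC5Pattern = decidable-stable (hasC5Pattern? G v) λ none → absurd none (Fin.any? far?)
      where
      absurd : ¬ HasC5Pattern G v → Dec (∃ Far) → ⊥
      absurd none (no noFar) = noDominatingVertex v λ u u≢v → near u≢v λ far-u → noFar (u , far-u)
      absurd none (yes (d , far-d)) = critical v λ (M , opt , Mv) →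
        colourInduced (λ u → ¬? (far? u)) d (λ near-d → near-d far-d) λ (j , j<χ , col) →
        ℕ.<⇒≱ j<χ (chromatic j (recolour none M opt Mv col))

theorem4p3 : (G : Graph) → MinimalCounterexample G → (v : V G) → InInducedC5 G v
theorem4p3 G ((α≤2 , h , χ , (_ , hadwiger) , (_ , chromatic) , h<χ) , minimal) v =
  HasC5Pattern⇒InInducedC5 G (Minimal.hasC5Pattern G α≤2 h χ hadwiger chromatic h<χ minimal v)
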